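{- Let $C$ be the set of elements of the free Catalan structure (equivalently, rooted plane trees, with size $|T|$ = number of edges). Let $$F=F(t,u)=\sum_{T\in C}t^{|T|}u^{\mathrm{leaves}(T)},\qquad G=G(t,p,q,u)=\sum_{T\in C}t^{|T|}p^{\mathrm{sub}(T)}q^{\mathrm{rpath}(T)}u^{\mathrm{leaves}(T)}$$ as formal power series. Then $$G(t,p,q,u)=u+\frac{tpqu\,(1-tF)}{(1-tpF)(1-tF-tq)}.$$ Equivalently, with $\Delta=(1-t+tu)^2-4tu$, $$G(t,p,q,u)=u+\frac{tpqu\,(1+t-tu+\sqrt{\Delta})}{2(1-tq-tpu)+(1-t+tu-\sqrt{\Delta})\,(tp(u+q-1)-1)}.$$
   Context: The free Catalan structure consists of the formal expressions $e$, $\lambda(t)$, and $\lambda(u)\oplus v$ with $v\neq e$, where $\oplus$ is associative with identity $e$; $|e|=0$, $|\lambda(t)|=|t|+1$, $|u\oplus v|=|u|+|v|$. It is isomorphic to rooted plane trees written as lists of children, with $e=[\,]$, $\lambda(T)=[T]$, and $\oplus$ = concatenation of child lists. Statistics (in each clause for $u\oplus v$ both $u,v\neq e$): $\mathrm{leaves}(e)=1$, $\mathrm{leaves}(\lambda(t))=\mathrm{leaves}(t)$, $\mathrm{leaves}(u\oplus v)=\mathrm{leaves}(u)+\mathrm{leaves}(v)$; $\mathrm{sub}(e)=0$, $\mathrm{sub}(\lambda(t))=1$, $\mathrm{sub}(u\oplus v)=\mathrm{sub}(u)+\mathrm{sub}(v)$; $\mathrm{rpath}(e)=0$, $\mathrm{rpath}(\lambda(t))=1+\mathrm{rpath}(t)$,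 $\mathrm{rpath}(u\oplus v)=\mathrm{rpath}(v)$. On plane trees these are the number of leaves, the number of children of the root, and the length of the rightmost path from the root. $\sqrt{\Delta}$ denotes the power series in $t$ with constant term $1$; $F$ satisfies $F(t,u)=\frac{1-t+tu-\sqrt{\Delta}}{2t}$. -}

module Defs where

open import Algebra.Bundles using (CommutativeRing)
import Algebra.Construct.Pointwise as Pointwise
import Algebra.Properties.Semiring.Exp as SemiringExp
import Algebra.Properties.Semiring.Mult as SemiringMult
import Algebra.Properties.Semiring.Sum as SemiringSum
open import Data.Empty using (⊥)
open import Data.Fin.Base using (Fin; toℕ; fromℕ<)
open import Data.Fin.Properties using (toℕ≤pred[n]; toℕ-fromℕ<; toℕ-injective)
open import Data.List.Base
  using (List; []; _∷_; map; foldr; concat; tabulate; cartesianProductWith)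
open import Data.List.Membership.Propositional using (_∈_)
open import Data.List.Membership.Propositional.Properties
  using (∈-concat⁺′; ∈-concat⁻′; ∈-tabulate⁺; ∈-tabulate⁻;
         ∈-cartesianProductWith⁺; ∈-cartesianProductWith⁻)
import Data.List.Relation.Unary.All.Properties as All
import Data.List.Relation.Unary.AllPairs.Properties as AllPairs
open import Data.List.Relation.Unary.All using ([])
open import Data.List.Relation.Unary.AllPairs using ([]; _∷_)
open import Data.List.Relation.Unary.Any using (here)
open import Data.List.Relation.Unary.Unique.Propositional using (Unique)
import Data.List.Relation.Unary.Unique.Propositional.Properties as Unique
open import Data.Nat.Base as ℕ using (ℕ; zero; suc; _∸_; _≤_; z≤n; s≤s)
import Data.Nat.Properties as ℕ
open import Data.Product.Base using (_×_; _,_; proj₁; proj₂)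
import Data.Rational.Properties as ℚ
open import Function.Base using (_∘_)
open import Level using (Level)
open import Relation.Binary.PropositionalEquality
  using (_≡_; _≢_; refl; sym; trans; cong; cong₂; subst; module ≡-Reasoning)
import Relation.Binary.Reasoning.Setoid as SetoidReasoning
open import Relation.Nullary.Negation using (contradiction)

------------------------------------------------------------------------
-- The free Catalan structure

infixr 5 λ⟨_⟩⊕_ _⊕_

-- λ⟨ u ⟩⊕ v is the expression λ(u) ⊕ v when v ≢ e, and λ(u) when v ≡ e.
-- As a plane tree, its first child is u and its other children form v.
data C : Set where
  e      : C
  λ⟨_⟩⊕_ : C → C → C

λ[_] : C → C
λ[ t ] = λ⟨ t ⟩⊕ e

_⊕_ : C → C → C
e            ⊕ w = w
(λ⟨ u ⟩⊕ v) ⊕ w = λ⟨ u ⟩⊕ (v ⊕ w)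

∣_∣ : C → ℕ
∣ e ∣          = 0
∣ λ⟨ u ⟩⊕ v ∣ = suc (∣ u ∣ ℕ.+ ∣ v ∣)

leaves : C → ℕ
leaves e                             = 1
leaves (λ⟨ u ⟩⊕ e)                 = leaves u
leaves (λ⟨ u ⟩⊕ v@(λ⟨ _ ⟩⊕ _)) = leaves u ℕ.+ leaves v

sub : C → ℕ
sub e            = 0
sub (λ⟨ _ ⟩⊕ v) = suc (sub v)

rpath : C → ℕ
rpath e                             = 0
rpath (λ⟨ u ⟩⊕ e)                 = suc (rpath u)
rpath (λ⟨ _ ⟩⊕ v@(λ⟨ _ ⟩⊕ _)) = rpath v

⊕-assoc : ∀ u v w → (u ⊕ v) ⊕ w ≡ u ⊕ (v ⊕ w)
⊕-assoc e            v w = refl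
⊕-assoc (λ⟨ x ⟩⊕ u) v w = cong (λ⟨ x ⟩⊕_) (⊕-assoc u v w)

⊕-identityʳ : ∀ u → u ⊕ e ≡ u
⊕-identityʳ e            = refl
⊕-identityʳ (λ⟨ x ⟩⊕ u) = cong (λ⟨ x ⟩⊕_) (⊕-identityʳ u)

∣λ∣ : ∀ t → ∣ λ[ t ] ∣ ≡ ∣ t ∣ ℕ.+ 1
∣λ∣ t = trans (cong suc (ℕ.+-identityʳ ∣ t ∣)) (ℕ.+-comm 1 ∣ t ∣)

∣⊕∣ : ∀ u v → ∣ u ⊕ v ∣ ≡ ∣ u ∣ ℕ.+ ∣ v ∣
∣⊕∣ e            v = refl
∣⊕∣ (λ⟨ x ⟩⊕ u) v = cong suc
  (trans (cong (∣ x ∣ ℕ.+_) (∣⊕∣ u v)) (sym (ℕ.+-assoc (∣ x ∣) (∣ u ∣) (∣ v ∣))))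

leaves-⊕ : ∀ u v → u ≢ e → v ≢ e → leaves (u ⊕ v) ≡ leaves u ℕ.+ leaves v
leaves-⊕ e                           v            u≢e v≢e = contradiction refl u≢e
leaves-⊕ (λ⟨ x ⟩⊕ e)               e            u≢e v≢e = contradiction refl v≢e
leaves-⊕ (λ⟨ x ⟩⊕ e)               (λ⟨ _ ⟩⊕ _) u≢e v≢e = refl
leaves-⊕ (λ⟨ x ⟩⊕ u@(λ⟨ _ ⟩⊕ _)) v            u≢e v≢e =
  trans (cong (leaves x ℕ.+_) (leaves-⊕ u v (λ ()) v≢e))
        (sym (ℕ.+-assoc (leaves x) (leaves u) (leaves v)))

sub-⊕ : ∀ u v → sub (u ⊕ v) ≡ sub u ℕ.+ sub v
sub-⊕ e            v = refl
sub-⊕ (λ⟨ _ ⟩⊕ u) v = cong suc (sub-⊕ u v)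

rpath-⊕ : ∀ u v → v ≢ e → rpath (u ⊕ v) ≡ rpath v
rpath-⊕ e                           v            v≢e = refl
rpath-⊕ (λ⟨ x ⟩⊕ e)               e            v≢e = contradiction refl v≢e
rpath-⊕ (λ⟨ x ⟩⊕ e)               (λ⟨ _ ⟩⊕ _) v≢e = refl
rpath-⊕ (λ⟨ x ⟩⊕ u@(λ⟨ _ ⟩⊕ _)) v            v≢e = rpath-⊕ u v v≢e

splits : (ℕ → List C) → (n : ℕ) → Fin (suc n) → List C
splits L n i = cartesianProductWith λ⟨_⟩⊕_ (L (toℕ i)) (L (n ∸ toℕ i))

-- enum k n lists the elements of size n, provided n ≤ k.  The bound k only
-- serves to make the recursion structural.
enum : ℕ → ℕ → List C
enum _       zero    = e ∷ []
enum zero    (suc _) = []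
enum (suc k) (suc n) = concat (tabulate (splits (enum k) n))

ofSize : ℕ → List C
ofSize n = enum n n

-- ofSize n lists every element of size n exactly once, and nothing else.

enum-sound : ∀ k n {T} → T ∈ enum k n → ∣ T ∣ ≡ n
enum-sound k       zero    (here refl) = refl
enum-sound (suc k) (suc n) T∈
  with _ , T∈xs , xs∈ ← ∈-concat⁻′ _ T∈
  with i , refl ← ∈-tabulate⁻ {f = splits (enum k) n} xs∈
  with u , v , u∈ , v∈ , refl ←
       ∈-cartesianProductWith⁻ λ⟨_⟩⊕_ (enum k (toℕ i)) (enum k (n ∸ toℕ i)) T∈xs
  = cong suc (trans (cong₂ ℕ._+_ (enum-sound k (toℕ i) u∈) (enum-sound k _ v∈))
                    (ℕ.m+[n∸m]≡n (toℕ≤pred[n] i)))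

enum-complete : ∀ k T → ∣ T ∣ ≤ k → T ∈ enum k ∣ T ∣
enum-complete k       e            _           = here refl
enum-complete (suc k) (λ⟨ u ⟩⊕ v) (s≤s ∣uv∣≤k) =
  ∈-concat⁺′ (∈-cartesianProductWith⁺ λ⟨_⟩⊕_ u∈ v∈)
    (∈-tabulate⁺ {f = splits (enum k) (∣ u ∣ ℕ.+ ∣ v ∣)} i)
  where
  i : Fin (suc (∣ u ∣ ℕ.+ ∣ v ∣))
  i = fromℕ< (s≤s (ℕ.m≤m+n (∣ u ∣) (∣ v ∣)))
  i≡ : toℕ i ≡ ∣ u ∣
  i≡ = toℕ-fromℕ< _
  u∈ : u ∈ enum k (toℕ i)
  u∈ = subst (λ m → u ∈ enum k m) (sym i≡)
         (enum-complete k u (ℕ.≤-trans (ℕ.m≤m+n _ _) ∣uv∣≤k))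
  v∈ : v ∈ enum k (∣ u ∣ ℕ.+ ∣ v ∣ ∸ toℕ i)
  v∈ = subst (λ m → v ∈ enum k m)
         (sym (trans (cong (∣ u ∣ ℕ.+ ∣ v ∣ ∸_) i≡) (ℕ.m+n∸m≡n (∣ u ∣) (∣ v ∣))))
         (enum-complete k v (ℕ.≤-trans (ℕ.m≤n+m _ _) ∣uv∣≤k))

enum-unique : ∀ k n → Unique (enum k n)
enum-unique zero    zero    = [] ∷ []
enum-unique (suc k) zero    = [] ∷ []
enum-unique zero    (suc n) = []
enum-unique (suc k) (suc n) = Unique.concat⁺
  (All.tabulate⁺ λ i → Unique.cartesianProductWith⁺ λ⟨_⟩⊕_ (λ { refl → refl , refl })
                         (enum-unique k (toℕ i)) (enum-unique k (n ∸ toℕ i)))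
  (AllPairs.tabulate⁺ disjoint)
  where
  disjoint : ∀ {i j} → i ≢ j → ∀ {T} → T ∈ splits (enum k) n i × T ∈ splits (enum k) n j → ⊥
  disjoint {i} {j} i≢j (T∈i , T∈j)
    with _ , _ , u∈  , _ , refl ← ∈-cartesianProductWith⁻ λ⟨_⟩⊕_ (enum k (toℕ i)) _ T∈i
    with _ , _ , u∈′ , _ , refl ← ∈-cartesianProductWith⁻ λ⟨_⟩⊕_ (enum k (toℕ j)) _ T∈j
    = i≢j (toℕ-injective
        (trans (sym (enum-sound k (toℕ i) u∈)) (enum-sound k (toℕ j) u∈′)))

ofSize-sound : ∀ n {T} → T ∈ ofSize n → ∣ T ∣ ≡ n
ofSize-sound n = enum-sound n n

ofSize-complete : ∀ T → T ∈ ofSize ∣ T ∣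
ofSize-complete T = enum-complete ∣ T ∣ T ℕ.≤-refl

ofSize-unique : ∀ n → Unique (ofSize n)
ofSize-unique n = enum-unique n n

------------------------------------------------------------------------
-- Formal power series in one variable over a commutative ring, given by
-- their sequences of coefficients

module PowerSeries {c ℓ : Level} (R : CommutativeRing c ℓ) where

  private module R = CommutativeRing R
  open R using (_≈_; _+_; _*_; 0#; 1#)
  open SemiringSum R.semiring using (sum-syntax; sum⁺-syntax)
  open SetoidReasoning R.setoid

  Series : Set c
  Series = ℕ → R.Carrier

  infix  4 _≋_
  infixl 7 _·_

  _≋_ : Series → Series → Set ℓ
  f ≋ g = ∀ n → f n ≈ g n

  _·_ : Series → Series → Series
  (f · g) n = ∑[ i ≤ n ] (f (toℕ i) * g (n ∸ toℕ i))

  const : R.Carrier → Series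
  const a zero    = a
  const a (suc _) = 0#

  X : Series
  X (suc zero) = 1#
  X _          = 0#

  -- The series ∑ₙ a(n) Xⁿ with a(n) the sum of w T over all T of size n,
  -- that is, the sum of w T · X ^ ∣ T ∣ over all T in C.
  generatingSeries : (C → R.Carrier) → Series
  generatingSeries w n = foldr _+_ 0# (map w (ofSize n))

  private
    ·-cong : ∀ {f f′ g g′} → f ≋ f′ → g ≋ g′ → f · g ≋ f′ · g′
    ·-cong f≋ g≋ zero    = R.+-congʳ (R.*-cong (f≋ 0) (g≋ 0))
    ·-cong f≋ g≋ (suc n) =
      R.+-cong (R.*-cong (f≋ 0) (g≋ (suc n))) (·-cong (f≋ ∘ suc) g≋ n)

    ·-sucʳ : ∀ f g n → (f · g) (suc n) ≈ f (suc n) * g 0 + (f · (g ∘ suc)) n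
    ·-sucʳ f g zero    = begin
      f 0 * g 1 + (f 1 * g 0 + 0#) ≈⟨ R.+-congˡ (R.+-identityʳ _) ⟩
      f 0 * g 1 + f 1 * g 0        ≈⟨ R.+-comm _ _ ⟩
      f 1 * g 0 + f 0 * g 1        ≈⟨ R.+-congˡ (R.+-identityʳ _) ⟨
      f 1 * g 0 + (f 0 * g 1 + 0#) ∎
    ·-sucʳ f g (suc n) = begin
      a + ((f ∘ suc) · g) (suc n) ≈⟨ R.+-congˡ (·-sucʳ (f ∘ suc) g n) ⟩
      a + (b + d)                 ≈⟨ R.+-assoc a b d ⟨
      a + b + d                   ≈⟨ R.+-congʳ (R.+-comm a b) ⟩
      b + a + d                   ≈⟨ R.+-assoc b a d ⟩
      b + (a + d)                 ∎
      where
      a = f 0 * g (suc (suc n))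
      b = f (suc (suc n)) * g 0
      d = ((f ∘ suc) · (g ∘ suc)) n

    ·-comm : ∀ f g → f · g ≋ g · f
    ·-comm f g zero    = R.+-congʳ (R.*-comm (f 0) (g 0))
    ·-comm f g (suc n) = begin
      f 0 * g (suc n) + ((f ∘ suc) · g) n ≈⟨ R.+-cong (R.*-comm _ _) (·-comm (f ∘ suc) g n) ⟩
      g (suc n) * f 0 + (g · (f ∘ suc)) n ≈⟨ ·-sucʳ g f n ⟨
      (g · f) (suc n)                     ∎

    +-interchange : ∀ a b c d → (a + b) + (c + d) ≈ (a + c) + (b + d)
    +-interchange a b c d = begin
      (a + b) + (c + d) ≈⟨ R.+-assoc a b _ ⟩
      a + (b + (c + d)) ≈⟨ R.+-congˡ (R.+-assoc b c d) ⟨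
      a + ((b + c) + d) ≈⟨ R.+-congˡ (R.+-congʳ (R.+-comm b c)) ⟩
      a + ((c + b) + d) ≈⟨ R.+-congˡ (R.+-assoc c b d) ⟩
      a + (c + (b + d)) ≈⟨ R.+-assoc a c _ ⟨
      (a + c) + (b + d) ∎

    ·-distribʳ : ∀ h f g n → ((λ m → f m + g m) · h) n ≈ (f · h) n + (g · h) n
    ·-distribʳ h f g zero    = begin
      (f 0 + g 0) * h 0 + 0#               ≈⟨ R.+-identityʳ _ ⟩
      (f 0 + g 0) * h 0                    ≈⟨ R.distribʳ _ _ _ ⟩
      f 0 * h 0 + g 0 * h 0                ≈⟨ R.+-cong (R.+-identityʳ _) (R.+-identityʳ _) ⟨
      (f 0 * h 0 + 0#) + (g 0 * h 0 + 0#)  ∎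
    ·-distribʳ h f g (suc n) = R.trans
      (R.+-cong (R.distribʳ _ _ _) (·-distribʳ h (f ∘ suc) (g ∘ suc) n))
      (+-interchange _ _ _ _)

    ·-distribˡ : ∀ h f g n → (h · (λ m → f m + g m)) n ≈ (h · f) n + (h · g) n
    ·-distribˡ h f g n = begin
      (h · (λ m → f m + g m)) n ≈⟨ ·-comm h (λ m → f m + g m) n ⟩
      ((λ m → f m + g m) · h) n ≈⟨ ·-distribʳ h f g n ⟩
      (f · h) n + (g · h) n     ≈⟨ R.+-cong (·-comm f h n) (·-comm g h n) ⟩
      (h · f) n + (h · g) n     ∎

    ·-scaleˡ : ∀ a f g n → ((λ m → a * f m) · g) n ≈ a * (f · g) n
    ·-scaleˡ a f g zero    = begin
      (a * f 0) * g 0 + 0# ≈⟨ R.+-identityʳ _ ⟩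
      (a * f 0) * g 0      ≈⟨ R.*-assoc _ _ _ ⟩
      a * (f 0 * g 0)      ≈⟨ R.*-congˡ (R.+-identityʳ _) ⟨
      a * (f 0 * g 0 + 0#) ∎
    ·-scaleˡ a f g (suc n) = R.trans
      (R.+-cong (R.*-assoc _ _ _) (·-scaleˡ a (f ∘ suc) g n))
      (R.sym (R.distribˡ _ _ _))

    ·-assoc : ∀ f g h → (f · g) · h ≋ f · (g · h)
    ·-assoc f g h zero    = R.+-congʳ (begin
      (f 0 * g 0 + 0#) * h 0 ≈⟨ R.*-congʳ (R.+-identityʳ _) ⟩
      (f 0 * g 0) * h 0      ≈⟨ R.*-assoc _ _ _ ⟩
      f 0 * (g 0 * h 0)      ≈⟨ R.*-congˡ (R.+-identityʳ _) ⟨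
      f 0 * (g 0 * h 0 + 0#) ∎)
    ·-assoc f g h (suc n) = begin
      (f 0 * g 0 + 0#) * h (suc n) + (((f · g) ∘ suc) · h) n
        ≈⟨ R.+-cong (R.trans (R.*-congʳ (R.+-identityʳ _)) (R.*-assoc _ _ _))
                    (·-distribʳ h (λ m → f 0 * g (suc m)) ((f ∘ suc) · g) n) ⟩
      f 0 * (g 0 * h (suc n)) + (((λ m → f 0 * g (suc m)) · h) n + (((f ∘ suc) · g) · h) n)
        ≈⟨ R.+-congˡ (R.+-cong (·-scaleˡ (f 0) (g ∘ suc) h n) (·-assoc (f ∘ suc) g h n)) ⟩
      f 0 * (g 0 * h (suc n)) + (f 0 * ((g ∘ suc) · h) n + ((f ∘ suc) · (g · h)) n)
        ≈⟨ R.+-assoc _ _ _ ⟨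
      f 0 * (g 0 * h (suc n)) + f 0 * ((g ∘ suc) · h) n + ((f ∘ suc) · (g · h)) n
        ≈⟨ R.+-congʳ (R.distribˡ _ _ _) ⟨
      f 0 * (g · h) (suc n) + ((f ∘ suc) · (g · h)) n ∎

    0·f≋0 : ∀ f n → ((λ _ → 0#) · f) n ≈ 0#
    0·f≋0 f zero    = R.trans (R.+-identityʳ _) (R.zeroˡ _)
    0·f≋0 f (suc n) = begin
      0# * f (suc n) + ((λ _ → 0#) · f) n ≈⟨ R.+-cong (R.zeroˡ _) (0·f≋0 f n) ⟩
      0# + 0#                             ≈⟨ R.+-identityʳ _ ⟩
      0#                                  ∎

    ·-identityˡ : ∀ f → const 1# · f ≋ f
    ·-identityˡ f zero    = R.trans (R.+-identityʳ _) (R.*-identityˡ _)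
    ·-identityˡ f (suc n) = begin
      1# * f (suc n) + ((λ _ → 0#) · f) n ≈⟨ R.+-cong (R.*-identityˡ _) (0·f≋0 f n) ⟩
      f (suc n) + 0#                      ≈⟨ R.+-identityʳ _ ⟩
      f (suc n)                           ∎

    ·-identityʳ : ∀ f → f · const 1# ≋ f
    ·-identityʳ f n = R.trans (·-comm f (const 1#) n) (·-identityˡ f n)

  seriesRing : CommutativeRing c ℓ
  seriesRing = record
    { Carrier = Series
    ; _≈_     = _≋_
    ; _+_     = λ f g n → f n + g n
    ; _*_     = _·_
    ; -_      = λ f n → R.- f n
    ; 0#      = λ _ → 0#
    ; 1#      = const 1#
    ; isCommutativeRing = record
      { isRing = record
        { +-isAbelianGroup = Pointwise.isAbelianGroup ℕ R.+-isAbelianGroup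
        ; *-cong           = ·-cong
        ; *-assoc          = ·-assoc
        ; *-identity       = ·-identityˡ , ·-identityʳ
        ; distrib          = ·-distribˡ , ·-distribʳ
        }
      ; *-comm = ·-comm
      }
    }

  infix 4 _IsSqrtOf_

  _IsSqrtOf_ : Series → Series → Set ℓ
  s IsSqrtOf f = (s · s ≋ f) × (s 0 ≈ 1#)

------------------------------------------------------------------------
-- ℚ[[u]], ℚ[[u]][[q]] and ℚ[[u]][[q]][[p]]; the last is ℚ[[p, q, u]].

module Pᵘ = PowerSeries ℚ.+-*-commutativeRing
module Pᵠ = PowerSeries Pᵘ.seriesRing
module Pᵖ = PowerSeries Pᵠ.seriesRing

-- ℚ[[p, q, u]][[t]], in which all the identities take place.
module Pᵗ = PowerSeries Pᵖ.seriesRing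

module Coefficients where
  open CommutativeRing Pᵖ.seriesRing using (Carrier; _*_; semiring)
  open SemiringExp semiring using (_^_)

  p q u : Carrier
  p = Pᵖ.X
  q = Pᵖ.const Pᵠ.X
  u = Pᵖ.const (Pᵠ.const Pᵘ.X)

  F G : Pᵗ.Series
  F = Pᵗ.generatingSeries λ T → u ^ leaves T
  G = Pᵗ.generatingSeries λ T → p ^ sub T * q ^ rpath T * u ^ leaves T

open CommutativeRing Pᵗ.seriesRing public
  using (Carrier; _≈_; _+_; _*_; _-_; 1#)
open SemiringMult (CommutativeRing.semiring Pᵗ.seriesRing) public
  using () renaming (_×_ to _⋆_)
open Pᵗ public using (_IsSqrtOf_)
open Coefficients public using (F; G)

t p q u : Carrier
t = Pᵗ.X
p = Pᵗ.const Coefficients.p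
q = Pᵗ.const Coefficients.q
u = Pᵗ.const Coefficients.u

Δ : Carrier
Δ = (1# - t + t * u) * (1# - t + t * u) - 4 ⋆ (t * u)

{-# OPTIONS --safe #-}
module Submission where

-- Splitting T as e, λ(a) or λ(a) ⊕ b with b ≠ e gives
--   F = u + t (F + F (F − u)),
--   H = u + t (q H + F (H − u)),   where H is G at p = 1,
--   G = u + t (p q H + p F (G − u)).
-- The last two equations are linear in H and G, which yields the first formula.
-- By the first equation, 1 − t + tu − 2tF is a square root of Δ; rewriting F in
-- terms of it turns the first fraction into the second, whose numerator and
-- denominator are both doubled.

import Defs
open Defs using (C; e; λ⟨_⟩⊕_; λ[_]; leaves; sub; rpath; enum; ofSize; splits; module PowerSeries)
open import Data.Product using (Σ; ∃!; ∃-syntax; _×_; _,_)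

open import Algebra.Bundles using (CommutativeRing)
import Algebra.Properties.Group as GroupProperties
import Algebra.Properties.Ring as RingProperties
import Algebra.Properties.Semiring.Exp as SemiringExp
import Algebra.Properties.Semiring.Mult as SemiringMult
import Algebra.Properties.Semiring.Mult.TCOptimised as SemiringMult′
import Algebra.Properties.Semiring.Sum as SemiringSum
import Algebra.Solver.Ring as RingSolver
open import Algebra.Solver.Ring.AlmostCommutativeRing
  using (_-Raw-AlmostCommutative⟶_; fromCommutativeRing)
open import Data.Fin.Base using (Fin; zero; suc; toℕ)
open import Data.Fin.Properties using (toℕ≤pred[n])
open import Data.Integer.Base as ℤ using (ℤ; -[1+_]; _⊖_; _◃_)
import Data.Integer.Properties as ℤ
open import Data.List.Base
  using (List; []; _∷_; _++_; map; foldr; concat; tabulate; cartesianProductWith)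
open import Data.List.Properties using (map-∘; tabulate-cong)
open import Data.Maybe.Base using (Maybe; just; nothing)
open import Data.Nat.Base as ℕ using (ℕ; zero; suc; _∸_; _≤_; _<_; s≤s)
import Data.Nat.Properties as ℕ
import Data.Rational.Base as ℚ
import Data.Rational.Properties as ℚ
open import Data.Sign.Base using (Sign)
open import Function.Base using (_∘_)
open import Level using (Level)
open import Relation.Binary.PropositionalEquality as ≡ using (_≡_)
import Relation.Binary.Reasoning.Setoid as SetoidReasoning
open import Relation.Nullary.Decidable using (yes; no)

-- Normalisation of ring expressions with integer coefficients.

module IntegerCoefficientSolver {c ℓ : Level} (R : CommutativeRing c ℓ) where

  private
    open module R = CommutativeRing R
      hiding (zero)
    open RingProperties ring
    open SemiringMult′ semiring using (1+×; ×-homo-+; ×1-homo-*) renaming (_×_ to _×′_)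
    open SetoidReasoning setoid

    -- The optimised multiple makes `1 ×′ 1#` equal to `1#` itself rather than `1# + 0#`, so `:1`
    -- denotes `1#` definitionally.
    ⟦_⟧ : ℤ → Carrier
    ⟦ ℤ.+ n    ⟧ = n ×′ 1#
    ⟦ -[1+ n ] ⟧ = - (suc n ×′ 1#)

    cancel-+ˡ : ∀ a x y → (a + x) - (a + y) ≈ x - y
    cancel-+ˡ a x y = begin
      (a + x) + - (a + y)     ≈⟨ +-congʳ (+-comm a x) ⟩
      (x + a) + - (a + y)     ≈⟨ +-congˡ (-‿+-comm a y) ⟨
      (x + a) + (- a + - y)   ≈⟨ +-assoc x a _ ⟩
      x + (a + (- a + - y))   ≈⟨ +-congˡ (+-assoc a (- a) (- y)) ⟨
      x + ((a + - a) + - y)   ≈⟨ +-congˡ (+-congʳ (-‿inverseʳ a)) ⟩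
      x + (0# + - y)          ≈⟨ +-congˡ (+-identityˡ (- y)) ⟩
      x + - y                 ∎

    ⟦⟧-⊖ : ∀ m n → ⟦ m ⊖ n ⟧ ≈ m ×′ 1# - n ×′ 1#
    ⟦⟧-⊖ m       zero    = begin
      m ×′ 1#        ≈⟨ +-identityʳ _ ⟨
      m ×′ 1# + 0#   ≈⟨ +-congˡ -0#≈0# ⟨
      m ×′ 1# - 0#   ∎
    ⟦⟧-⊖ zero    (suc n) = sym (+-identityˡ _)
    ⟦⟧-⊖ (suc m) (suc n) = begin
      ⟦ suc m ⊖ suc n ⟧                   ≡⟨ ≡.cong ⟦_⟧ (ℤ.[1+m]⊖[1+n]≡m⊖n m n) ⟩
      ⟦ m ⊖ n ⟧                           ≈⟨ ⟦⟧-⊖ m n ⟩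
      m ×′ 1# - n ×′ 1#                   ≈⟨ cancel-+ˡ 1# _ _ ⟨
      (1# + m ×′ 1#) - (1# + n ×′ 1#)     ≈⟨ +-cong (1+× m 1#) (-‿cong (1+× n 1#)) ⟨
      suc m ×′ 1# - suc n ×′ 1#           ∎

    -- Integer products of mixed sign have the form `Sign.- ◃ n`, which at `zero` computes to `+ 0`
    -- and not to a negated term.
    ⟦⟧-neg◃ : ∀ n → ⟦ Sign.- ◃ n ⟧ ≈ - (n ×′ 1#)
    ⟦⟧-neg◃ zero    = sym -0#≈0#
    ⟦⟧-neg◃ (suc n) = refl

    +-homo : ∀ i j → ⟦ i ℤ.+ j ⟧ ≈ ⟦ i ⟧ + ⟦ j ⟧
    +-homo (ℤ.+ m)    (ℤ.+ n)    = ×-homo-+ 1# m n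
    +-homo (ℤ.+ m)    -[1+ n ]   = ⟦⟧-⊖ m (suc n)
    +-homo -[1+ m ]   (ℤ.+ n)    = trans (⟦⟧-⊖ n (suc m)) (+-comm _ _)
    +-homo -[1+ m ]   -[1+ n ]   = begin
      - (suc (suc (m ℕ.+ n)) ×′ 1#)          ≡⟨ ≡.cong (λ k → - (suc k ×′ 1#)) (ℕ.+-suc m n) ⟨
      - ((suc m ℕ.+ suc n) ×′ 1#)            ≈⟨ -‿cong (×-homo-+ 1# (suc m) (suc n)) ⟩
      - (suc m ×′ 1# + suc n ×′ 1#)          ≈⟨ -‿+-comm _ _ ⟨
      - (suc m ×′ 1#) + - (suc n ×′ 1#)      ∎

    *-homo : ∀ i j → ⟦ i ℤ.* j ⟧ ≈ ⟦ i ⟧ * ⟦ j ⟧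
    *-homo (ℤ.+ m)  (ℤ.+ n)  = trans
      (reflexive (≡.cong ⟦_⟧ (ℤ.+◃n≡+n (m ℕ.* n)))) (×1-homo-* m n)
    *-homo (ℤ.+ m)  -[1+ n ] = begin
      ⟦ Sign.- ◃ (m ℕ.* suc n) ⟧    ≈⟨ ⟦⟧-neg◃ (m ℕ.* suc n) ⟩
      - ((m ℕ.* suc n) ×′ 1#)       ≈⟨ -‿cong (×1-homo-* m (suc n)) ⟩
      - (m ×′ 1# * suc n ×′ 1#)     ≈⟨ -‿distribʳ-* _ _ ⟩
      m ×′ 1# * - (suc n ×′ 1#)     ∎
    *-homo -[1+ m ] (ℤ.+ n)  = begin
      ⟦ Sign.- ◃ (suc m ℕ.* n) ⟧    ≈⟨ ⟦⟧-neg◃ (suc m ℕ.* n) ⟩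
      - ((suc m ℕ.* n) ×′ 1#)       ≈⟨ -‿cong (×1-homo-* (suc m) n) ⟩
      - (suc m ×′ 1# * n ×′ 1#)     ≈⟨ -‿distribˡ-* _ _ ⟩
      - (suc m ×′ 1#) * n ×′ 1#     ∎
    *-homo -[1+ m ] -[1+ n ] = begin
      (suc m ℕ.* suc n) ×′ 1#               ≈⟨ ×1-homo-* (suc m) (suc n) ⟩
      suc m ×′ 1# * suc n ×′ 1#             ≈⟨ -‿involutive _ ⟨
      - - (suc m ×′ 1# * suc n ×′ 1#)       ≈⟨ -‿cong (-‿distribˡ-* _ _) ⟩
      - (- (suc m ×′ 1#) * suc n ×′ 1#)     ≈⟨ -‿distribʳ-* _ _ ⟩
      - (suc m ×′ 1#) * - (suc n ×′ 1#)     ∎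

    -‿homo : ∀ i → ⟦ ℤ.- i ⟧ ≈ - ⟦ i ⟧
    -‿homo (ℤ.+ zero)  = sym -0#≈0#
    -‿homo (ℤ.+ suc n) = refl
    -‿homo -[1+ n ]    = sym (-‿involutive _)

    homomorphism : ℤ.+-*-rawRing -Raw-AlmostCommutative⟶ fromCommutativeRing R
    homomorphism = record
      { ⟦_⟧    = ⟦_⟧
      ; +-homo = +-homo
      ; *-homo = *-homo
      ; -‿homo = -‿homo
      ; 0-homo = refl
      ; 1-homo = refl
      }

    decide : ∀ i j → Maybe (⟦ i ⟧ ≈ ⟦ j ⟧)
    decide i j with i ℤ.≟ j
    ... | yes i≡j = just (reflexive (≡.cong ⟦_⟧ i≡j))
    ... | no _    = nothing

  open RingSolver ℤ.+-*-rawRing (fromCommutativeRing R) homomorphism decide public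
    using (solve; con; _:=_; _:+_; _:*_; _:-_; :-_; Polynomial)

  :0 :1 : ∀ {n} → Polynomial n
  :0 = con (ℤ.+ 0)
  :1 = con (ℤ.+ 1)

  -- These unfold to the same sums as n × x does.
  2:×_ 4:×_ : ∀ {n} → Polynomial n → Polynomial n
  2:× x = x :+ (x :+ :0)
  4:× x = x :+ (x :+ (x :+ (x :+ :0)))

-- Equations certified as linear combinations.

module RingLemmas {c ℓ : Level} (R : CommutativeRing c ℓ) where

  open CommutativeRing R
  open SemiringMult semiring using () renaming (_×_ to _⋆_)
  open GroupProperties +-group using (x≈y⇒x∙y⁻¹≈ε; x∙y⁻¹≈ε⇒x≈y)
  open SetoidReasoning setoid
  open IntegerCoefficientSolver R

  -- In the following lemmas an equation is certified as a linear combination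
  -- of the hypotheses; the certificate is a ring identity.

  combination₁ : ∀ {x y a₁ l₁ r₁} → l₁ ≈ r₁ →
                 x - y ≈ a₁ * (l₁ - r₁) → x ≈ y
  combination₁ {x} {y} {a₁} {l₁} {r₁} eq₁ x-y≈ = x∙y⁻¹≈ε⇒x≈y x y (begin
    x - y           ≈⟨ x-y≈ ⟩
    a₁ * (l₁ - r₁)  ≈⟨ *-congˡ (x≈y⇒x∙y⁻¹≈ε eq₁) ⟩
    a₁ * 0#         ≈⟨ zeroʳ a₁ ⟩
    0#              ∎)

  combination₂ : ∀ {x y a₁ l₁ r₁ a₂ l₂ r₂} → l₁ ≈ r₁ → l₂ ≈ r₂ →
                 x - y ≈ a₁ * (l₁ - r₁) + a₂ * (l₂ - r₂) → x ≈ y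
  combination₂ {x} {y} {a₁} {l₁} {r₁} {a₂} {l₂} {r₂} eq₁ eq₂ x-y≈ = combination₁ eq₁ (begin
    x - y                             ≈⟨ x-y≈ ⟩
    a₁ * (l₁ - r₁) + a₂ * (l₂ - r₂)   ≈⟨ +-congˡ (*-congˡ (x≈y⇒x∙y⁻¹≈ε eq₂)) ⟩
    a₁ * (l₁ - r₁) + a₂ * 0#          ≈⟨ +-congˡ (zeroʳ a₂) ⟩
    a₁ * (l₁ - r₁) + 0#               ≈⟨ +-identityʳ _ ⟩
    a₁ * (l₁ - r₁)                    ∎)

  combination₃ : ∀ {x y a₁ l₁ r₁ a₂ l₂ r₂ a₃ l₃ r₃} → l₁ ≈ r₁ → l₂ ≈ r₂ → l₃ ≈ r₃ →
                 x - y ≈ a₁ * (l₁ - r₁) + a₂ * (l₂ - r₂) + a₃ * (l₃ - r₃) → x ≈ y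
  combination₃ {x} {y} {a₁} {l₁} {r₁} {a₂} {l₂} {r₂} {a₃} {l₃} {r₃} eq₁ eq₂ eq₃ x-y≈ =
    combination₂ eq₁ eq₂ (begin
      x - y                                              ≈⟨ x-y≈ ⟩
      a₁ * (l₁ - r₁) + a₂ * (l₂ - r₂) + a₃ * (l₃ - r₃)   ≈⟨ +-congˡ (*-congˡ (x≈y⇒x∙y⁻¹≈ε eq₃)) ⟩
      a₁ * (l₁ - r₁) + a₂ * (l₂ - r₂) + a₃ * 0#          ≈⟨ +-congˡ (zeroʳ a₃) ⟩
      a₁ * (l₁ - r₁) + a₂ * (l₂ - r₂) + 0#               ≈⟨ +-identityʳ _ ⟩
      a₁ * (l₁ - r₁) + a₂ * (l₂ - r₂)                    ∎)

  -- x − y = (x² − y²) / (x + y)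
  square-injective : ∀ {h k d x y} → h * (x + y) * k ≈ 1# →
                     x * x ≈ d → y * y ≈ d → x ≈ y
  square-injective {h} {k} {d} {x} {y} invertible x²≈d y²≈d =
    combination₃ invertible x²≈d y²≈d
      (solve 5 (λ h k d x y →
        x :- y :=
          (y :- x) :* (h :* (x :+ y) :* k :- :1)
            :+ (h :* k) :* (x :* x :- d)
            :+ (:- (h :* k)) :* (y :* y :- d))
        refl h k d x y)

  -- Algebraic consequences of the functional equations.

  module CatalanEquations {t p q u F H G : Carrier}
    (F-eq : F ≈ u + t * (F + F * (F - u)))
    (H-eq : H ≈ u + t * (q * H + F * (H - u)))
    (G-eq : G ≈ u + t * (p * (q * H) + (p * F) * (G - u)))
    where

    √Δ-of : Carrier
    √Δ-of = 1# - t + t * u - 2 ⋆ (t * F)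

    -- `F-eq` is the quadratic `t F² - (1 - t + t u) F + u = 0`, whose discriminant is Δ. Completing
    -- the square multiplies it by `4 t`, and no division by `t` is required.
    √Δ-of-square : √Δ-of * √Δ-of ≈
      (1# - t + t * u) * (1# - t + t * u) - 4 ⋆ (t * u)
    √Δ-of-square = combination₁ F-eq
      (solve 3 (λ t u F →
        let s = :1 :- t :+ t :* u :- 2:× (t :* F) in
        s :* s :- ((:1 :- t :+ t :* u) :* (:1 :- t :+ t :* u) :- 4:× (t :* u))
          := (:- 4:× t) :* (F :- (u :+ t :* (F :+ F :* (F :- u)))))
        refl t u F)

    -- With `D₁ = 1 - t p F` and `D₂ = 1 - t F - t q`, `H-eq` reads `D₂ H = u (1 - t F)` and `G-eq`
    -- reads `D₁ (G - u) = t p q H`. Eliminating `H` gives `D₁ D₂ (G - u) = t p q u (1 - t F)`, and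
    -- `D⁻¹` inverts `D₁ D₂`.
    G-rational : ∀ {D⁻¹} → ((1# - t * p * F) * (1# - t * F - t * q)) * D⁻¹ ≈ 1# →
                 G ≈ u + (t * p * q * u * (1# - t * F)) * D⁻¹
    G-rational {D⁻¹} inverse = combination₃ inverse G-eq H-eq
      (solve 8 (λ t p q u F H G D⁻¹ →
        let D₁ = :1 :- t :* p :* F
            D₂ = :1 :- t :* F :- t :* q
        in
        G :- (u :+ (t :* p :* q :* u :* (:1 :- t :* F)) :* D⁻¹)
          := (u :- G) :* (D₁ :* D₂ :* D⁻¹ :- :1)
               :+ (D⁻¹ :* D₂) :* (G :- (u :+ t :* (p :* (q :* H) :+ (p :* F) :* (G :- u))))
               :+ (D⁻¹ :* (t :* p :* q)) :* (H :- (u :+ t :* (q :* H :+ F :* (H :- u)))))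
        refl t p q u F H G D⁻¹)

    module _ {h : Carrier} (2h≈1 : h + h ≈ 1#) where

      -- This denominator minus twice the first one is `2 t p` times the difference of the two sides
      -- of `F-eq`, hence zero. Its inverse is therefore half of `D⁻¹`.
      √Δ-denominator-inverse : ∀ {D⁻¹} →
        ((1# - t * p * F) * (1# - t * F - t * q)) * D⁻¹ ≈ 1# →
        (2 ⋆ (1# - t * q - t * p * u)
          + (1# - t + t * u - √Δ-of) * (t * p * (u + q - 1#) - 1#)) * (h * D⁻¹) ≈ 1#
      √Δ-denominator-inverse {D⁻¹} inverse = combination₃ inverse F-eq 2h≈1
        (solve 7 (λ t p q u F h D⁻¹ →
          let D = (:1 :- t :* p :* F) :* (:1 :- t :* F :- t :* q)
              s = :1 :- t :+ t :* u :- 2:× (t :* F)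
          in
          (2:× (:1 :- t :* q :- t :* p :* u)
            :+ (:1 :- t :+ t :* u :- s) :* (t :* p :* (u :+ q :- :1) :- :1)) :* (h :* D⁻¹) :- :1
            := :1 :* (D :* D⁻¹ :- :1)
                 :+ (2:× (t :* p) :* h :* D⁻¹) :* (F :- (u :+ t :* (F :+ F :* (F :- u))))
                 :+ (D :* D⁻¹) :* (h :+ h :- :1))
          refl t p q u F h D⁻¹)

      -- Substituting `√Δ-of` turns `1# + t - t * u + √Δ-of` into `2 (1 - t F)`, and `h` cancels the
      -- 2.
      G-√Δ : ∀ {D⁻¹} → ((1# - t * p * F) * (1# - t * F - t * q)) * D⁻¹ ≈ 1# →
             G ≈ u + (t * p * q * u * (1# + t - t * u + √Δ-of)) * (h * D⁻¹)
      G-√Δ {D⁻¹} inverse = trans (G-rational inverse) (combination₁ 2h≈1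
        (solve 7 (λ t p q u F h D⁻¹ →
          let N = t :* p :* q :* u :* (:1 :- t :* F)
              s = :1 :- t :+ t :* u :- 2:× (t :* F)
          in
          (u :+ N :* D⁻¹) :- (u :+ (t :* p :* q :* u :* (:1 :+ t :- t :* u :+ s)) :* (h :* D⁻¹))
            := (:- (N :* D⁻¹)) :* (h :+ h :- :1))
          refl t p q u F h D⁻¹))

-- Independence of the enumeration from its bound.

-- Listing size `suc n` consults only sizes up to `n`, which both smaller bounds still cover. This
-- lets the sublists in `ofSize (suc n)`, all made with bound `n`, be replaced by values of
-- `ofSize`.
enum-stable : ∀ k l {n} → n ≤ k → n ≤ l → enum k n ≡ enum l n
enum-stable k       l       {zero}  _         _         = ≡.refl
enum-stable (suc k) (suc l) {suc n} (s≤s n≤k) (s≤s n≤l) =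
  ≡.cong concat (tabulate-cong λ i →
    ≡.cong₂ (cartesianProductWith λ⟨_⟩⊕_)
      (stable (toℕ≤pred[n] i))
      (stable (ℕ.m∸n≤m n (toℕ i))))
  where
  stable : ∀ {m} → m ≤ n → enum k m ≡ enum l m
  stable m≤n = enum-stable k l (ℕ.≤-trans m≤n n≤k) (ℕ.≤-trans m≤n n≤l)

enum-ofSize : ∀ {k n} → n ≤ k → enum k n ≡ ofSize n
enum-ofSize {k} {n} n≤k = enum-stable k n n≤k ℕ.≤-refl

-- Coefficients, inverses and square roots of power series.

module SeriesLemmas {c ℓ : Level} (R : CommutativeRing c ℓ) where

  open PowerSeries R
  private
    module S = CommutativeRing seriesRing
    module R = CommutativeRing R
  open R using (_≈_; _+_; _*_; _-_; -_; 0#; 1#)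
  open SemiringSum R.semiring using (sum; sum-cong-≋)
  open SetoidReasoning R.setoid
  open IntegerCoefficientSolver R

  const-cong : ∀ {a b} → a ≈ b → const a ≋ const b
  const-cong a≈b zero    = a≈b
  const-cong a≈b (suc n) = R.refl

  const-· : ∀ a f n → (const a · f) n ≈ a * f n
  const-· a f zero    = R.+-identityʳ _
  const-· a f (suc n) = R.trans (R.+-congˡ (S.zeroˡ f n)) (R.+-identityʳ _)

  const-half : ∀ {h} → h + h ≈ 1# → const h S.+ const h ≋ S.1#
  const-half 2h≈1 zero    = 2h≈1
  const-half 2h≈1 (suc n) = R.+-identityʳ 0#

  X·-zero : ∀ f → (X · f) 0 ≈ 0#
  X·-zero f = R.trans (R.+-identityʳ _) (R.zeroˡ _)

  X·-suc : ∀ f n → (X · f) (suc n) ≈ f n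
  X·-suc f n = begin
    0# * f (suc n) + ((X ∘ suc) · f) n ≈⟨ R.+-cong (R.zeroˡ _) (S.*-congʳ {f} X∘suc≋1 n) ⟩
    0# + (S.1# · f) n                  ≈⟨ R.+-identityˡ _ ⟩
    (S.1# · f) n                       ≈⟨ S.*-identityˡ f n ⟩
    f n                                ∎
    where
    X∘suc≋1 : (X ∘ suc) ≋ S.1#
    X∘suc≋1 zero    = R.refl
    X∘suc≋1 (suc _) = R.refl

  ·-cong-≤ : ∀ f {g g′} n → (∀ {m} → m ≤ n → g m ≈ g′ m) → (f · g) n ≈ (f · g′) n
  ·-cong-≤ f n g≈ = sum-cong-≋ {suc n} λ i → R.*-congˡ {f (toℕ i)} (g≈ (ℕ.m∸n≤m n (toℕ i)))

  -- The inverse of f is the limit of iterating the t-adic contraction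
  -- g ↦ 1 − (f − 1) g, whose n-th coefficient is exact after suc n steps.
  module _ (f : Series) where

    private
      step : Series → Series
      step g zero    = 1#
      step g (suc n) = - ((f ∘ suc) · g) n

      approx : ℕ → Series
      approx zero    = S.0#
      approx (suc k) = step (approx k)

      -- Coefficient `suc n` of `step g` reads `g` only up to `n`, so each step fixes one more
      -- coefficient.
      approx-stable : ∀ k l {n} → n < k → n < l → approx k n ≈ approx l n
      approx-stable (suc k) (suc l) {zero}  _         _         = R.refl
      approx-stable (suc k) (suc l) {suc n} (s≤s n<k) (s≤s n<l) =
        R.-‿cong (·-cong-≤ (f ∘ suc) n λ m≤n →
          approx-stable k l (ℕ.≤-<-trans m≤n n<k) (ℕ.≤-<-trans m≤n n<l))

      limit : Series
      limit n = approx (suc n) n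

      limit-fixed : limit ≋ step limit
      limit-fixed zero    = R.refl
      -- The left side uses stage `suc n` for all coefficients `m ≤ n`, while `limit` takes each
      -- from its own stage `suc m`.
      limit-fixed (suc n) = R.-‿cong (·-cong-≤ (f ∘ suc) n λ {m} m≤n →
        approx-stable (suc n) (suc m) (s≤s m≤n) ℕ.≤-refl)

    constant-1⇒invertible : f 0 ≈ 1# → ∃[ g ] f · g ≋ S.1#
    constant-1⇒invertible f₀≈1 = limit , inverse
      where
      inverse : f · limit ≋ S.1#
      inverse zero    = R.trans (R.+-identityʳ _) (R.trans (R.*-identityʳ _) f₀≈1)
      inverse (suc n) = begin
        f 0 * limit (suc n) + ((f ∘ suc) · limit) n
          ≈⟨ R.+-congʳ (R.*-cong f₀≈1 (limit-fixed (suc n))) ⟩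
        1# * - ((f ∘ suc) · limit) n + ((f ∘ suc) · limit) n
          ≈⟨ R.+-congʳ (R.*-identityˡ _) ⟩
        - ((f ∘ suc) · limit) n + ((f ∘ suc) · limit) n
          ≈⟨ R.-‿inverseˡ _ ⟩
        0# ∎

  -- Since both roots start with 1, `h (f + g)` has constant term `2 h = 1` and is invertible, so
  -- `f + g` can be cancelled from `f² - g² = 0`.
  sqrt-unique : ∀ {h d f g} → h + h ≈ 1# → f IsSqrtOf d → g IsSqrtOf d → f ≋ g
  sqrt-unique {h} {d} {f} {g} 2h≈1 (f²≋d , f₀≈1) (g²≋d , g₀≈1) =
    let _ , invertible = constant-1⇒invertible (const h · (f S.+ g)) (begin
          (const h · (f S.+ g)) 0 ≈⟨ const-· h (f S.+ g) 0 ⟩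
          h * (f 0 + g 0)         ≈⟨ R.*-congˡ (R.+-cong f₀≈1 g₀≈1) ⟩
          h * (1# + 1#)           ≈⟨ R.distribˡ h 1# 1# ⟩
          h * 1# + h * 1#         ≈⟨ R.+-cong (R.*-identityʳ h) (R.*-identityʳ h) ⟩
          h + h                   ≈⟨ 2h≈1 ⟩
          1#                      ∎)
    in RingLemmas.square-injective seriesRing {const h} {_} {d} {f} {g} invertible f²≋d g²≋d

  -- Generating series of weights on plane trees.

  Weight : Set c
  Weight = C → R.Carrier

  total : Weight → List C → R.Carrier
  total w L = foldr _+_ 0# (map w L)

  total-cong : ∀ {v w : Weight} → (∀ T → v T ≈ w T) → ∀ L → total v L ≈ total w L
  total-cong v≈w []      = R.refl
  total-cong v≈w (T ∷ L) = R.+-cong (v≈w T) (total-cong v≈w L)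

  total-++ : ∀ w L M → total w (L ++ M) ≈ total w L + total w M
  total-++ w []      M = R.sym (R.+-identityˡ _)
  total-++ w (T ∷ L) M = R.trans (R.+-congˡ (total-++ w L M)) (R.sym (R.+-assoc _ _ _))

  total-+ : ∀ v w L → total (λ T → v T + w T) L ≈ total v L + total w L
  total-+ v w []      = R.sym (R.+-identityʳ 0#)
  total-+ v w (T ∷ L) = R.trans (R.+-congˡ (total-+ v w L))
    (solve 4 (λ a b c d → (a :+ b) :+ (c :+ d) := (a :+ c) :+ (b :+ d)) R.refl
      (v T) (w T) (total v L) (total w L))

  total-scale : ∀ a w L → total (λ T → a * w T) L ≈ a * total w L
  total-scale a w []      = R.sym (R.zeroʳ a)
  total-scale a w (T ∷ L) = R.trans (R.+-congˡ (total-scale a w L)) (R.sym (R.distribˡ _ _ _))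

  total-concat-tabulate : ∀ w {n} (Ls : Fin n → List C) →
                          total w (concat (tabulate Ls)) ≈ sum (total w ∘ Ls)
  total-concat-tabulate w {zero}  Ls = R.refl
  total-concat-tabulate w {suc n} Ls = R.trans
    (total-++ w (Ls zero) (concat (tabulate (Ls ∘ suc))))
    (R.+-congˡ (total-concat-tabulate w (Ls ∘ suc)))

  -- The weights that factor over the first child and the remaining children; for these the
  -- recursion of `enum` becomes a product of series.
  node : R.Carrier → Weight → Weight → Weight
  node k x y e            = k
  node k x y (λ⟨ a ⟩⊕ b) = x a * y b

  total-node : ∀ k x y L M → total (node k x y) (cartesianProductWith λ⟨_⟩⊕_ L M) ≈
                             total x L * total y M
  total-node k x y []      M = R.sym (R.zeroˡ _)
  total-node k x y (T ∷ L) M = begin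
    total w (map (λ⟨ T ⟩⊕_) M ++ LM)               ≈⟨ total-++ w (map (λ⟨ T ⟩⊕_) M) LM ⟩
    total w (map (λ⟨ T ⟩⊕_) M) + total w LM        ≡⟨ ≡.cong (λ l → foldr _+_ 0# l + total w LM) (map-∘ M) ⟨
    total (λ S → x T * y S) M + total w LM          ≈⟨ R.+-cong (total-scale (x T) y M) (total-node k x y L M) ⟩
    x T * total y M + total x L * total y M         ≈⟨ R.distribʳ _ _ _ ⟨
    (x T + total x L) * total y M                   ∎
    where
    w  = node k x y
    LM = cartesianProductWith λ⟨_⟩⊕_ L M

  generatingSeries-cong : ∀ {v w : Weight} → (∀ T → v T ≈ w T) →
                          generatingSeries v ≋ generatingSeries w
  generatingSeries-cong v≈w n = total-cong v≈w (ofSize n)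

  generatingSeries-+ : ∀ v w → generatingSeries (λ T → v T + w T) ≋
                               generatingSeries v S.+ generatingSeries w
  generatingSeries-+ v w n = total-+ v w (ofSize n)

  generatingSeries-scale : ∀ a w → generatingSeries (λ T → a * w T) ≋
                                   const a · generatingSeries w
  generatingSeries-scale a w n =
    R.trans (total-scale a w (ofSize n)) (R.sym (const-· a (generatingSeries w) n))

  generatingSeries-0 : generatingSeries (λ _ → 0#) ≋ S.0#
  generatingSeries-0 n = begin
    total (λ _ → 0#) (ofSize n)      ≈⟨ total-cong (λ _ → R.zeroˡ 0#) (ofSize n) ⟨
    total (λ _ → 0# * 0#) (ofSize n) ≈⟨ total-scale 0# (λ _ → 0#) (ofSize n) ⟩
    0# * total (λ _ → 0#) (ofSize n) ≈⟨ R.zeroˡ _ ⟩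
    0#                               ∎

  -- A tree of size `suc n` is a pair of trees of sizes `i` and `n ∸ i`, so summing over `splits` is
  -- the convolution defining `_·_`; the root edge to the first child accounts for `X`.
  generatingSeries-node : ∀ k x y → generatingSeries (node k x y) ≋
    const k S.+ X · (generatingSeries x · generatingSeries y)
  generatingSeries-node k x y zero    = R.+-congˡ (R.sym (X·-zero (generatingSeries x · generatingSeries y)))
  generatingSeries-node k x y (suc n) = begin
    total w (concat (tabulate (splits (enum n) n)))
      ≈⟨ total-concat-tabulate w (splits (enum n) n) ⟩
    sum (total w ∘ splits (enum n) n)
      ≈⟨ sum-cong-≋ {suc n} (λ i → R.trans
           (total-node k x y (enum n (toℕ i)) (enum n (n ∸ toℕ i)))
           (R.reflexive (≡.cong₂ (λ L M → total x L * total y M)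
             (enum-ofSize (toℕ≤pred[n] i))
             (enum-ofSize (ℕ.m∸n≤m n (toℕ i)))))) ⟩
    (generatingSeries x · generatingSeries y) n
      ≈⟨ X·-suc (generatingSeries x · generatingSeries y) n ⟨
    (X · (generatingSeries x · generatingSeries y)) (suc n)
      ≈⟨ R.+-identityˡ _ ⟨
    0# + (X · (generatingSeries x · generatingSeries y)) (suc n) ∎
    where w = node k x y

  private
    -- The indicator of `e`, written as a `node` so that its series comes from
    -- `generatingSeries-node`.
    [_≡e] : Weight
    [_≡e] = node 1# (λ _ → 0#) (λ _ → 0#)

    generatingSeries-≡e : generatingSeries [_≡e] ≋ S.1#
    generatingSeries-≡e = S.trans (generatingSeries-node 1# (λ _ → 0#) (λ _ → 0#))
      (S.trans
        (S.+-congˡ (S.trans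
          (S.*-congˡ {X} (S.trans
            (S.*-congʳ {generatingSeries (λ _ → 0#)} generatingSeries-0)
            (S.zeroˡ (generatingSeries (λ _ → 0#)))))
          (S.zeroʳ X)))
        (S.+-identityʳ S.1#))

    _off-e : Weight → Weight
    (y off-e) e              = 0#
    (y off-e) T@(λ⟨ _ ⟩⊕ _) = y T

    split-off-e : ∀ y T → y T ≈ (y off-e) T + y e * [ T ≡e]
    split-off-e y e            = R.sym (R.trans (R.+-identityˡ _) (R.*-identityʳ _))
    split-off-e y (λ⟨ _ ⟩⊕ _) = R.sym (R.trans
      (R.+-congˡ (R.trans (R.*-congˡ (R.zeroˡ 0#)) (R.zeroʳ _)))
      (R.+-identityʳ _))

    generatingSeries-off-e : ∀ y → generatingSeries (y off-e) ≋ generatingSeries y S.- const (y e)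
    generatingSeries-off-e y n = begin
      f n                          ≈⟨ R.+-identityʳ _ ⟨
      f n + 0#                     ≈⟨ R.+-congˡ (R.-‿inverseʳ _) ⟨
      f n + (k n - k n)            ≈⟨ R.+-assoc _ _ _ ⟨
      (f n + k n) - k n            ≈⟨ R.+-congʳ total≈ ⟨
      generatingSeries y n - k n   ∎
      where
      f = generatingSeries (y off-e)
      k = const (y e)
      total≈ : generatingSeries y n ≈ f n + k n
      total≈ = begin
        generatingSeries y n
          ≈⟨ generatingSeries-cong (split-off-e y) n ⟩
        generatingSeries (λ T → (y off-e) T + y e * [ T ≡e]) n
          ≈⟨ generatingSeries-+ (y off-e) (λ T → y e * [ T ≡e]) n ⟩
        f n + generatingSeries (λ T → y e * [ T ≡e]) n
          ≈⟨ R.+-congˡ (generatingSeries-scale (y e) [_≡e] n) ⟩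
        f n + (k · generatingSeries [_≡e]) n
          ≈⟨ R.+-congˡ (S.*-congˡ {k} generatingSeries-≡e n) ⟩
        f n + (k · S.1#) n
          ≈⟨ R.+-congˡ (S.*-identityʳ k n) ⟩
        f n + k n ∎

  -- The weights in question treat a lone child differently from a first child with siblings, so
  -- they are not of the form `node`. Each is a sum of two that are: `atomic` lives on `e` and
  -- `λ[ a ]`, `composite` on trees with at least two children. Excluding `e` as the remainder in
  -- `composite` subtracts `const l`.
  generatingSeries-decomposition : ∀ {w x₀ x y k l} →
    w e ≈ k →
    y e ≈ l →
    (∀ a → w λ[ a ] ≈ x₀ a) →
    (∀ a b c → w (λ⟨ a ⟩⊕ λ⟨ b ⟩⊕ c) ≈ x a * y (λ⟨ b ⟩⊕ c)) →
    generatingSeries w ≋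
    const k S.+ X · (generatingSeries x₀ S.+ generatingSeries x · (generatingSeries y S.- const l))
  generatingSeries-decomposition {w} {x₀} {x} {y} {k} {l} w-e y-e w-λ w-⊕ n = begin
    generatingSeries w n
      ≈⟨ generatingSeries-cong w≈ n ⟩
    generatingSeries (λ T → atomic T + composite T) n
      ≈⟨ generatingSeries-+ atomic composite n ⟩
    generatingSeries atomic n + generatingSeries composite n
      ≈⟨ R.+-cong (atomic-series n) (composite-series n) ⟩
    (const k n + (X · f₀) n) + (X · (f · g₋)) n
      ≈⟨ R.+-assoc _ _ _ ⟩
    const k n + ((X · f₀) n + (X · (f · g₋)) n)
      ≈⟨ R.+-congˡ (S.distribˡ X f₀ (f · g₋) n) ⟨
    const k n + (X · (f₀ S.+ f · g₋)) n ∎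
    where
    atomic    = node k x₀ [_≡e]
    composite = node 0# x (y off-e)
    f₀ = generatingSeries x₀
    f  = generatingSeries x
    g₋ = generatingSeries y S.- const l
    const-0 : const 0# ≋ S.0#
    const-0 zero    = R.refl
    const-0 (suc _) = R.refl
    atomic-series : generatingSeries atomic ≋ const k S.+ X · f₀
    atomic-series = S.trans (generatingSeries-node k x₀ [_≡e])
      (S.+-congˡ {const k} (S.*-congˡ {X}
        (S.trans (S.*-congˡ {f₀} generatingSeries-≡e) (S.*-identityʳ f₀))))
    composite-series : generatingSeries composite ≋ X · (f · g₋)
    composite-series = S.trans (generatingSeries-node 0# x (y off-e)) (S.trans
      (S.+-cong const-0 (S.*-congˡ {X} (S.*-congˡ {f} (S.trans
        (generatingSeries-off-e y)
        (S.+-congˡ {generatingSeries y} (S.-‿cong (const-cong y-e)))))))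
      (S.+-identityˡ (X · (f · g₋))))
    w≈ : ∀ T → w T ≈ atomic T + composite T
    w≈ e                        = R.trans w-e (R.sym (R.+-identityʳ k))
    w≈ (λ⟨ a ⟩⊕ e)             = R.trans (w-λ a) (R.sym (R.trans
      (R.+-cong (R.*-identityʳ _) (R.zeroʳ _)) (R.+-identityʳ _)))
    w≈ (λ⟨ a ⟩⊕ λ⟨ b ⟩⊕ c) = R.trans (w-⊕ a b c) (R.sym (R.trans
      (R.+-congʳ (R.trans (R.*-congˡ (R.zeroˡ 0#)) (R.zeroʳ _))) (R.+-identityˡ _)))

  -- Constant terms of the denominator and of the root.

  open SemiringMult S.semiring using () renaming (_×_ to _⋆_)

  denominator-constant : ∀ p q f →
    ((S.1# S.- X · p · f) · (S.1# S.- X · f S.- X · q)) 0 ≈ 1#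
  denominator-constant p q f = solve 3 (λ p q f →
    -- Coefficient 0 of a product unfolds to `f 0 * g 0 + 0#`, and `X 0` to `0#`; this explains the
    -- zeros.
    (:1 :- ((:0 :* p :+ :0) :* f :+ :0)) :* (:1 :- (:0 :* f :+ :0) :- (:0 :* q :+ :0)) :+ :0
      := :1) R.refl (p 0) (q 0) (f 0)

  √Δ-constant : ∀ u f → (S.1# S.- X S.+ X · u S.- 2 ⋆ (X · f)) 0 ≈ 1#
  √Δ-constant u f = solve 2 (λ u f →
    :1 :- :0 :+ (:0 :* u :+ :0) :- 2:× (:0 :* f :+ :0) := :1) R.refl (u 0) (f 0)

  -- Functional equations for `F`, `H` and `G`.

  module _ (p q u : R.Carrier) where

    open SemiringExp R.semiring using (_^_; ^-homo-*)

    private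
      weightF weightH weightG : Weight
      weightF T = u ^ leaves T
      weightH T = q ^ rpath T * u ^ leaves T
      weightG T = p ^ sub T * q ^ rpath T * u ^ leaves T

      F G : Series
      F = generatingSeries weightF
      G = generatingSeries weightG

    H : Series
    H = generatingSeries weightH

    F-equation : F ≋ const u S.+ X · (F S.+ F · (F S.- const u))
    F-equation = generatingSeries-decomposition {weightF} {weightF} {weightF} {weightF}
      (R.*-identityʳ u) (R.*-identityʳ u)
      (λ _ → R.refl)
      (λ a b c → ^-homo-* u (leaves a) (leaves (λ⟨ b ⟩⊕ c)))

    -- The rightmost path runs through the last child only: a lone child is weighted by `q` times
    -- its own `weightH`, while a child with siblings after it contributes just its leaves.
    H-equation : H ≋ const u S.+ X · (const q · H S.+ F · (H S.- const u))
    H-equation = S.trans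
      (generatingSeries-decomposition {weightH} {λ T → q * weightH T} {weightF} {weightH}
        H-e H-e
        (λ _ → R.*-assoc _ _ _)
        (λ a b c → let T = λ⟨ b ⟩⊕ c in R.trans
          (R.*-congˡ (^-homo-* u (leaves a) (leaves T)))
          (solve 3 (λ r x y → r :* (x :* y) := x :* (r :* y)) R.refl
            (q ^ rpath T) (u ^ leaves a) (u ^ leaves T))))
      (S.+-congˡ {const u} (S.*-congˡ {X} (S.+-congʳ {F · (H S.- const u)}
        (generatingSeries-scale q weightH))))
      where
      H-e : weightH e ≈ u
      H-e = R.trans (R.*-identityˡ _) (R.*-identityʳ u)

    -- `sub λ[ a ]` is 1 whatever `sub a` is, so a lone child enters through `H`, not `G`. An
    -- earlier child contributes one `p` and its leaves, hence `const p · F`.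
    G-equation : G ≋ const u S.+
      X · (const p · (const q · H) S.+ (const p · F) · (G S.- const u))
    G-equation = S.trans
      (generatingSeries-decomposition
        {weightG} {λ T → p * (q * weightH T)} {λ T → p * weightF T} {weightG}
        G-e G-e
        (λ a → solve 4 (λ p q r x → p :* :1 :* (q :* r) :* x := p :* (q :* (r :* x))) R.refl
          p q (q ^ rpath a) (u ^ leaves a))
        (λ a b c → let T = λ⟨ b ⟩⊕ c in R.trans
          (R.*-congˡ (^-homo-* u (leaves a) (leaves T)))
          (solve 5 (λ p s r x y → p :* s :* r :* (x :* y) := p :* x :* (s :* r :* y)) R.refl
            p (p ^ sub T) (q ^ rpath T) (u ^ leaves a) (u ^ leaves T))))
      (S.+-congˡ {const u} (S.*-congˡ {X} (S.+-cong
        (S.trans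
          (generatingSeries-scale p (λ T → q * weightH T))
          (S.*-congˡ {const p} (generatingSeries-scale q weightH)))
        (S.*-congʳ {G S.- const u} (generatingSeries-scale p weightF)))))
      where
      G-e : weightG e ≈ u
      G-e = solve 1 (λ u → :1 :* :1 :* (u :* :1) := u) R.refl u

-- The identities over the rationals.

open Defs

private
  module Lᵘ = SeriesLemmas ℚ.+-*-commutativeRing
  module Lᵠ = SeriesLemmas Pᵘ.seriesRing
  module Lᵖ = SeriesLemmas Pᵠ.seriesRing
  module Lᵗ = SeriesLemmas Pᵖ.seriesRing

  -- The rational one half, embedded through the layers for `u`, `q` and `p`; it serves both
  -- uniqueness of the root and the doubled fraction.
  ½ᵖ : CommutativeRing.Carrier Pᵖ.seriesRing
  ½ᵖ = Pᵖ.const (Pᵠ.const (Pᵘ.const ℚ.½))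

  ½ᵖ+½ᵖ≈1 : let module P = CommutativeRing Pᵖ.seriesRing in (½ᵖ P.+ ½ᵖ) P.≈ P.1#
  ½ᵖ+½ᵖ≈1 = Lᵖ.const-half (Lᵠ.const-half (Lᵘ.const-half ≡.refl))

  ½ H : Carrier
  ½ = Pᵗ.const ½ᵖ
  H = Lᵗ.H Coefficients.p Coefficients.q Coefficients.u

-- A fraction is rendered as multiplication by an inverse of its denominator; inverses in a
-- commutative ring are unique, so this is unambiguous.
theorem4p3 : (∃[ D⁻¹ ]
    ((1# - t * p * F) * (1# - t * F - t * q)) * D⁻¹ ≈ 1#
    × G ≈ u + (t * p * q * u * (1# - t * F)) * D⁻¹)
    × Σ (∃! _≈_ (λ s → s IsSqrtOf Δ)) λ (√Δ , _) →
    (∃[ D⁻¹ ]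
    (2 ⋆ (1# - t * q - t * p * u)
    + (1# - t + t * u - √Δ) * (t * p * (u + q - 1#) - 1#)) * D⁻¹ ≈ 1#
    × G ≈ u + (t * p * q * u * (1# + t - t * u + √Δ)) * D⁻¹)
theorem4p3 =
  -- At `t = 0` both factors of `D` are 1.
  let D⁻¹ , inverse = Lᵗ.constant-1⇒invertible D (Lᵗ.denominator-constant p q F)
  in  (D⁻¹ , inverse , G-rational {D⁻¹} inverse)
    , ( √Δ-of
      , (√Δ-of-square , Lᵗ.√Δ-constant u F)
      , λ {s} → Lᵗ.sqrt-unique {½ᵖ} {Δ} {√Δ-of} {s} ½ᵖ+½ᵖ≈1 (√Δ-of-square , Lᵗ.√Δ-constant u F)
      )
    -- The second denominator equals `2 D`, which dictates this witness.
    , ( ½ * D⁻¹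
      , √Δ-denominator-inverse {½} 2½≈1 {D⁻¹} inverse
      , G-√Δ {½} 2½≈1 {D⁻¹} inverse
      )
  where
  D : Carrier
  D = (1# - t * p * F) * (1# - t * F - t * q)
  2½≈1 : ½ + ½ ≈ 1#
  2½≈1 = Lᵗ.const-half {½ᵖ} ½ᵖ+½ᵖ≈1
  open RingLemmas.CatalanEquations Pᵗ.seriesRing {t} {p} {q} {u} {F} {H} {G}
    (Lᵗ.F-equation Coefficients.p Coefficients.q Coefficients.u)
    (Lᵗ.H-equation Coefficients.p Coefficients.q Coefficients.u)
    (Lᵗ.G-equation Coefficients.p Coefficients.q Coefficients.u)
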